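{- Let $U=\{1,\dots,n\}$ with distance function $d$ and continuation probabilities $p_i\in[a,b]$ for all $i\in U$, where $0<a\le b<1$. Let $\tau$ be an integer with $2\le\tau\le n$. Then the B$\tau$I algorithm provides a $\frac{a^2(1-b)(1-b^{\tau-1})}{a^2+(\tau-1)b^{\tau+1}}$-approximation guarantee for MaxOHP. That is, for any ordering $O$ output by the algorithm, $$\mathcal{H}(O)\ \ge\ \frac{a^2(1-b)(1-b^{\tau-1})}{a^2+(\tau-1)b^{\tau+1}}\,\max_{O'}\mathcal{H}(O'),$$ the maximum being over all orderings $O'$ of $U$.
   Context: The distance function $d:U\times U\to\mathbb{R}_{\ge0}$ is symmetric with $d(i,i)=0$. For an ordering $O=(\pi(1),\dots,\pi(n))$ of $U$, let $O_k=(\pi(1),\dots,\pi(k))$ and $p_{O_k}=\prod_{t=1}^kp_{\pi(t)}$. The ordered Hamiltonian path objective is $\mathcal{H}(O)=\sum_{i=1}^{n-1}W_{O_i}\,d(\pi(i),\pi(i+1))$ with $W_{O_i}=\sum_{j=i+1}^np_{O_j}$. MaxOHP asks for an ordering of $U$ maximizing $\mathcal{H}$. The B$\tau$I algorithm (non-uniform case) chooses a sequence $O_\tau=(\pi(1),\dots,\pi(\tau))$ of $\tau$ distinct items maximizing $\tilde{\mathcal{H}}(O_\tau)=\sum_{i=1}^{\tau-1}\sum_{j=i+1}^{\tau}p_{O_j}\,d(\pi(i),\pi(i+1))$ over all sequences of $\tau$ distinct items of $U$, and then extends it to an ordering of all of $U$ by appending the remaining items in an arbitrary order. -}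

module Defs where

open import Algebra.Apartness.Bundles using (HeytingField; HeytingCommutativeRing)
open import Algebra.Bundles using (CommutativeRing)
import Algebra.Properties.Monoid.Sum as MonoidSum
import Algebra.Properties.Monoid.Mult as MonoidMult
import Algebra.Properties.Semiring.Exp as SemiringExp
open import Data.Bool.Base using (if_then_else_)
open import Data.Empty using (⊥-elim)
open import Data.Fin.Base using (Fin; Fin′; zero; suc; toℕ; inject₁; inject!; inject≤)
open import Data.Fin.Permutation using (Permutation′; _⟨$⟩ʳ_)
open import Data.Nat.Base as ℕ using (ℕ; zero; suc; _<ᵇ_; _∸_)
open import Data.Product.Base using (proj₁; proj₂)
open import Data.Sum.Base using (_⊎_; inj₁; inj₂)
open import Function.Bundles using (_↣_; Injection)
open import Level using (_⊔_) renaming (suc to lsuc)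
open import Relation.Binary.Structures using (IsStrictPartialOrder)
open import Relation.Binary.PropositionalEquality.Core using (_≡_)
open import Relation.Nullary.Negation using (¬_)

-- Ordered fields, standing in for ℝ.  The axioms are the constructive ones
-- (apartness in place of a decidable order), so that constructive models of
-- the real numbers are instances as well as ℚ and, classically, every ordered
-- field in the usual sense.

record OrderedField c ℓ₁ ℓ₂ : Set (lsuc (c ⊔ ℓ₁ ⊔ ℓ₂)) where
  infix 4 _<_ _≤_
  field
    heytingField : HeytingField c ℓ₁ ℓ₂

  open HeytingField heytingField public

  field
    _<_                  : Carrier → Carrier → Set ℓ₂
    isStrictPartialOrder : IsStrictPartialOrder _≈_ _<_
    #⇒<⊎>                : ∀ {x y} → x # y → x < y ⊎ y < x
    <⇒#                  : ∀ {x y} → x < y → x # y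
    +-monoʳ-<            : ∀ x {y z} → y < z → x + y < x + z
    *-pos                : ∀ {x y} → 0# < x → 0# < y → 0# < x * y

  open IsStrictPartialOrder isStrictPartialOrder public
    using (<-resp-≈; <-respˡ-≈; <-respʳ-≈)
    renaming (irrefl to <-irrefl; trans to <-trans; asym to <-asym)

  _≤_ : Carrier → Carrier → Set ℓ₂
  x ≤ y = ¬ (y < x)

  commutativeRing : CommutativeRing c ℓ₁
  commutativeRing = HeytingCommutativeRing.commutativeRing heytingCommutativeRing

  open CommutativeRing commutativeRing public
    using (semiring; +-monoid; *-monoid)
  open SemiringExp semiring public using (_^_)
  open MonoidMult +-monoid public using (_×_)
  open MonoidSum +-monoid public using (sum; sum-syntax)
  open MonoidSum *-monoid public using ()
    renaming (sum to product)

  -- The library field inverts x - 0#, which is ≈ x.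
  recip : ∀ x → 0# < x → Carrier
  recip x 0<x = proj₁ (#⇒invertible (#-sym (<⇒# 0<x)))

  <-≤-trans : ∀ {x y z} → x < y → y ≤ z → x < z
  <-≤-trans {x} {y} {z} x<y y≤z with #-cotrans (<⇒# x<y) z
  ... | inj₁ x#z with #⇒<⊎> x#z
  ...   | inj₁ x<z = x<z
  ...   | inj₂ z<x = ⊥-elim (y≤z (<-trans z<x x<y))
  <-≤-trans {x} {y} {z} x<y y≤z | inj₂ z#y with #⇒<⊎> z#y
  ...   | inj₁ z<y = ⊥-elim (y≤z z<y)
  ...   | inj₂ y<z = <-trans x<y y<z

  +-pos : ∀ {x y} → 0# < x → 0# < y → 0# < x + y
  +-pos {x} 0<x 0<y = <-trans 0<x (<-respˡ-≈ (+-identityʳ x) (+-monoʳ-< x 0<y))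

  ^-pos : ∀ {x} k → 0# < x → 0# < x ^ suc k
  ^-pos {x} zero    0<x = <-respʳ-≈ (sym (*-identityʳ x)) 0<x
  ^-pos     (suc k) 0<x = *-pos 0<x (^-pos k 0<x)

  ×-pos : ∀ {x} k → 0# < x → 0# < suc k × x
  ×-pos {x} zero    0<x = <-respʳ-≈ (sym (+-identityʳ x)) 0<x
  ×-pos     (suc k) 0<x = +-pos 0<x (×-pos k 0<x)

  +×-pos : ∀ {x y} k → 0# < x → 0# < y → 0# < x + k × y
  +×-pos {x} zero    0<x _   = <-respʳ-≈ (sym (+-identityʳ x)) 0<x
  +×-pos     (suc k) 0<x 0<y = +-pos 0<x (×-pos k 0<y)

module _ {c ℓ₁ ℓ₂} (F : OrderedField c ℓ₁ ℓ₂) where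
  open OrderedField F

  record IsDistance {n} (d : Fin n → Fin n → Carrier) : Set (ℓ₁ ⊔ ℓ₂) where
    field
      nonneg   : ∀ i j → 0# ≤ d i j
      d-sym    : ∀ i j → d i j ≈ d j i
      diagonal : ∀ i → d i i ≈ 0#

  ratioDenominator : (a b : Carrier) (τ : ℕ) → Carrier
  ratioDenominator a b τ = a ^ 2 + (τ ∸ 1) × (b ^ suc τ)

  ratioDenominator-pos : ∀ {a b} → 0# < a → a ≤ b → ∀ τ → 0# < ratioDenominator a b τ
  ratioDenominator-pos 0<a a≤b τ =
    +×-pos (τ ∸ 1) (^-pos 1 0<a) (^-pos τ (<-≤-trans 0<a a≤b))

  approximationRatio : ∀ {a b} → 0# < a → a ≤ b → ℕ → Carrier
  approximationRatio {a} {b} 0<a a≤b τ =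
    (a ^ 2 * (1# - b) * (1# - b ^ (τ ∸ 1)))
      * recip (ratioDenominator a b τ) (ratioDenominator-pos 0<a a≤b τ)

-- The ground set U is Fin n, and positions are counted from 0.

module OrderedHamiltonianPath
  {c ℓ₁ ℓ₂} (F : OrderedField c ℓ₁ ℓ₂) {n : ℕ}
  (p : Fin n → OrderedField.Carrier F)
  (d : Fin n → Fin n → OrderedField.Carrier F) where

  open OrderedField F

  -- The product of p over positions 0, …, j, that is, p_{O_{j+1}}.
  prefixProb : ∀ {k} → (Fin k → Fin n) → Fin k → Carrier
  prefixProb π j = product (λ (t : Fin′ (suc j)) → p (π (inject! t)))

  W : ∀ {k} → (Fin k → Fin n) → Fin k → Carrier
  W {k} π i = ∑[ j < k ] (if toℕ i <ᵇ toℕ j then prefixProb π j else 0#)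

  pathObjective : ∀ {k} → (Fin k → Fin n) → Carrier
  pathObjective {zero}  π = 0#
  pathObjective {suc m} π =
    ∑[ i < m ] (W π (inject₁ i) * d (π (inject₁ i)) (π (suc i)))

  Ordering : Set
  Ordering = Permutation′ n

  ℋ : Ordering → Carrier
  ℋ O = pathObjective (O ⟨$⟩ʳ_)

  DistinctSequence : ℕ → Set
  DistinctSequence k = Fin k ↣ Fin n

  truncatedObjective : ∀ {k} → (Fin k → Fin n) → Carrier
  truncatedObjective {zero}  π = 0#
  truncatedObjective {suc m} π =
    ∑[ i < m ] ∑[ j < suc m ]
      (if toℕ i <ᵇ toℕ j
        then prefixProb π j * d (π (inject₁ i)) (π (suc i))
        else 0#)

  ℋ̃ : ∀ {k} → DistinctSequence k → Carrier
  ℋ̃ S = truncatedObjective (Injection.to S)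

  -- O is a possible output of the algorithm, for some choice among the
  -- maximizers of ℋ̃ and some order of the remaining items.
  record BτIOutput (τ : ℕ) (τ≤n : τ ℕ.≤ n) (O : Ordering) : Set ℓ₂ where
    field
      Oτ      : DistinctSequence τ
      maximal : ∀ (S : DistinctSequence τ) → ℋ̃ S ≤ ℋ̃ Oτ
      extends : ∀ (i : Fin τ) → O ⟨$⟩ʳ inject≤ i τ≤n ≡ Injection.to Oτ i

  -- The value of O is at least α times the maximum of ℋ over all orderings.
  AchievesRatio : Carrier → Ordering → Set ℓ₂
  AchievesRatio α O = ∀ (O′ : Ordering) → α * ℋ O′ ≤ ℋ O

{-# OPTIONS --safe #-}
-- Put s = τ - 1 and let V be the optimum of ℋ̃; then V ≤ ℋ O, since extending a
-- sequence only adds nonnegative terms.  Continue an ordering O′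
-- cyclically; as τ ≤ n, any τ consecutive items are distinct, so their
-- truncated value is at most V.  Cut the edges of O′ into windows of s edges.
-- The weights beyond the last item of a window form a series dominated by a
-- geometric one of ratio b, so truncating them costs a factor of at most
-- 1/(1 - b), and the window number r, being reached with probability at most
-- b^(r s), contributes at most b^(r s) V / (1 - b).  Summing over r gives
-- (1 - b)(1 - b^s) ℋ O′ ≤ V, which is stronger than the claim because
-- a² ≤ a² + s b^(τ+1).
module Submission where

open import Defs
import Algebra.Bundles as Bundles
import Algebra.Properties.Semiring.Sum as SemiringSum
open import Data.Bool.Base using (true; false; if_then_else_)
open import Data.Fin.Base using (Fin; zero; suc; toℕ; inject₁; inject≤)
open import Data.Fin.Permutation using (_⟨$⟩ʳ_)
open import Data.Fin.Properties using (toℕ-injective; toℕ<n; toℕ-fromℕ<; toℕ-inject≤; toℕ-inject₁)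
open import Data.Nat.Base as ℕ using (ℕ; zero; suc; _<ᵇ_; _%_)
open import Data.Nat.DivMod using (_mod_; %-distribˡ-+; [m+kn]%n≡m%n; m<n⇒m%n≡m; m%n<n)
import Data.Nat.Properties as ℕₚ
open import Data.Nat.Solver using (module +-*-Solver)
open import Data.Product.Base using (proj₁; proj₂)
open import Data.Sum.Base using (inj₁; inj₂)
open import Function.Base using (_∘_)
open import Function.Bundles using (Injection; mk↣)
open import Function.Properties.Inverse using (↔⇒↣)
open import Function.Definitions using (Injective)
open import Relation.Binary.Bundles using (Preorder)
open import Relation.Binary.PropositionalEquality as ≡ using (_≡_)
open import Relation.Nullary.Negation using (¬_; contradiction)

-- Cyclic continuation of finite sequences, and their tails.

cyclic : ∀ {a} {A : Set a} {n} → (Fin (suc n) → A) → ℕ → A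
cyclic {n = n} f t = f (t mod suc n)

toℕ-mod : ∀ {n} (i : Fin (suc n)) → toℕ i mod suc n ≡ i
toℕ-mod {n} i = toℕ-injective
  (≡.trans (toℕ-fromℕ< (m%n<n (toℕ i) (suc n))) (m<n⇒m%n≡m (toℕ<n i)))

cyclic-toℕ : ∀ {a} {A : Set a} {n} (f : Fin (suc n) → A) i → cyclic f (toℕ i) ≡ f i
cyclic-toℕ f i = ≡.cong f (toℕ-mod i)

-- Adding k * n to k + i replaces it by i + k * suc n.
%-cancelˡ-+ : ∀ n k i j → (k ℕ.+ i) % suc n ≡ (k ℕ.+ j) % suc n → i % suc n ≡ j % suc n
%-cancelˡ-+ n k i j eq = begin
  i % suc n                                                  ≡⟨ shift i ⟩
  ((k ℕ.* n) % suc n ℕ.+ (k ℕ.+ i) % suc n) % suc n          ≡⟨ ≡.cong (λ r → ((k ℕ.* n) % suc n ℕ.+ r) % suc n) eq ⟩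
  ((k ℕ.* n) % suc n ℕ.+ (k ℕ.+ j) % suc n) % suc n          ≡⟨ shift j ⟨
  j % suc n                                                  ∎
  where
  open ≡.≡-Reasoning
  open +-*-Solver
  shift : ∀ l → l % suc n ≡ ((k ℕ.* n) % suc n ℕ.+ (k ℕ.+ l) % suc n) % suc n
  shift l = begin
    l % suc n                            ≡⟨ [m+kn]%n≡m%n l k (suc n) ⟨
    (l ℕ.+ k ℕ.* suc n) % suc n          ≡⟨ ≡.cong (_% suc n)
      (solve 3 (λ n k l → l :+ k :* (con 1 :+ n) := k :* n :+ (k :+ l)) ≡.refl n k l) ⟩
    (k ℕ.* n ℕ.+ (k ℕ.+ l)) % suc n      ≡⟨ %-distribˡ-+ (k ℕ.* n) (k ℕ.+ l) (suc n) ⟩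
    _                                    ∎

-- The common shift `k` cancels modulo `suc n`; offsets inside the window are below `suc n`, hence
-- equal to their own residues.
mod-window-injective : ∀ {m n} → m ℕ.≤ suc n → ∀ k →
  Injective {A = Fin m} _≡_ _≡_ (λ i → (k ℕ.+ toℕ i) mod suc n)
mod-window-injective {m} {n} m≤n k {i} {j} eq = toℕ-injective (begin
  toℕ i          ≡⟨ m<n⇒m%n≡m (bound i) ⟨
  toℕ i % suc n  ≡⟨ %-cancelˡ-+ n k (toℕ i) (toℕ j) (begin
    (k ℕ.+ toℕ i) % suc n        ≡⟨ toℕ-fromℕ< (m%n<n (k ℕ.+ toℕ i) (suc n)) ⟨
    toℕ ((k ℕ.+ toℕ i) mod suc n) ≡⟨ ≡.cong toℕ eq ⟩
    toℕ ((k ℕ.+ toℕ j) mod suc n) ≡⟨ toℕ-fromℕ< (m%n<n (k ℕ.+ toℕ j) (suc n)) ⟩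
    (k ℕ.+ toℕ j) % suc n        ∎) ⟩
  toℕ j % suc n  ≡⟨ m<n⇒m%n≡m (bound j) ⟩
  toℕ j          ∎)
  where
  open ≡.≡-Reasoning
  bound : ∀ (l : Fin m) → toℕ l ℕ.< suc n
  bound l = ℕₚ.<-≤-trans (toℕ<n l) m≤n

-- The recursion, unlike λ i → x (k + i), makes drop-drop an equality of
-- functions.
drop : ∀ {a} {A : Set a} → ℕ → (ℕ → A) → ℕ → A
drop zero    x = x
drop (suc k) x = drop k (x ∘ suc)

drop-lookup : ∀ {a} {A : Set a} k (x : ℕ → A) i → drop k x i ≡ x (k ℕ.+ i)
drop-lookup zero    x i = ≡.refl
drop-lookup (suc k) x i = drop-lookup k (x ∘ suc) i

drop-drop : ∀ {a} {A : Set a} j k (x : ℕ → A) → drop k (drop j x) ≡ drop (j ℕ.+ k) x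
drop-drop zero    k x = ≡.refl
drop-drop (suc j) k x = drop-drop j k (x ∘ suc)

-- Weak inequalities in an ordered field, without deciding the order.

module OrderedFieldProperties {c ℓ₁ ℓ₂} (F : OrderedField c ℓ₁ ℓ₂) where
  open OrderedField F

  commutativeSemiring : Bundles.CommutativeSemiring c ℓ₁
  commutativeSemiring = Bundles.CommutativeRing.commutativeSemiring commutativeRing

  ≤-reflexive : ∀ {x y} → x ≈ y → x ≤ y
  ≤-reflexive x≈y y<x = <-irrefl (sym x≈y) y<x

  ≤-refl : ∀ {x} → x ≤ x
  ≤-refl = ≤-reflexive refl

  ≤-trans : ∀ {x y z} → x ≤ y → y ≤ z → x ≤ z
  ≤-trans x≤y y≤z z<x = y≤z (<-≤-trans z<x x≤y)

  <⇒≤ : ∀ {x y} → x < y → x ≤ y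
  <⇒≤ = <-asym

  ≤-preorder : Preorder c ℓ₁ ℓ₂
  ≤-preorder = record
    { Carrier    = Carrier
    ; _≈_        = _≈_
    ; _≲_        = _≤_
    ; isPreorder = record
      { isEquivalence = isEquivalence
      ; reflexive     = ≤-reflexive
      ; trans         = ≤-trans
      }
    }

  open import Relation.Binary.Reasoning.Preorder ≤-preorder

  +-cancel-neg : ∀ x y → - x + (x + y) ≈ y
  +-cancel-neg x y = trans (sym (+-assoc (- x) x y))
    (trans (+-congʳ (-‿inverseˡ x)) (+-identityˡ y))

  -- By contraposition: adding `- x` to the strict inequality to be refuted cancels `x`.
  +-monoʳ-≤ : ∀ x {y z} → y ≤ z → x + y ≤ x + z
  +-monoʳ-≤ x {y} {z} y≤z x+z<x+y = y≤z
    (<-respʳ-≈ (+-cancel-neg x y) (<-respˡ-≈ (+-cancel-neg x z) (+-monoʳ-< (- x) x+z<x+y)))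

  +-mono-≤ : ∀ {x y u v} → x ≤ y → u ≤ v → x + u ≤ y + v
  +-mono-≤ {x} {y} {u} {v} x≤y u≤v = begin
    x + u ≲⟨ +-monoʳ-≤ x u≤v ⟩
    x + v ≈⟨ +-comm x v ⟩
    v + x ≲⟨ +-monoʳ-≤ v x≤y ⟩
    v + y ≈⟨ +-comm v y ⟩
    y + v ∎

  x≤x+y : ∀ {x y} → 0# ≤ y → x ≤ x + y
  x≤x+y {x} {y} 0≤y = begin
    x      ≈⟨ +-identityʳ x ⟨
    x + 0# ≲⟨ +-monoʳ-≤ x 0≤y ⟩
    x + y  ∎

  +-nonneg : ∀ {x y} → 0# ≤ x → 0# ≤ y → 0# ≤ x + y
  +-nonneg 0≤x 0≤y = ≤-trans 0≤x (x≤x+y 0≤y)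

  -- x * y < 0# rules out x ≈ 0# and y ≈ 0#, and tightness turns this into
  -- the double negation of x # 0# and y # 0#.
  *-nonneg : ∀ {x y} → 0# ≤ x → 0# ≤ y → 0# ≤ x * y
  *-nonneg {x} {y} 0≤x 0≤y xy<0 = ¬¬# x x≉0 λ x#0 → ¬¬# y y≉0 λ y#0 →
    <-asym xy<0 (*-pos (positive 0≤x x#0) (positive 0≤y y#0))
    where
    ¬¬# : ∀ z → ¬ (z ≈ 0#) → ¬ ¬ (z # 0#)
    ¬¬# z z≉0 ¬z#0 = z≉0 (proj₁ (tight z 0#) ¬z#0)
    x≉0 : ¬ (x ≈ 0#)
    x≉0 x≈0 = <-irrefl (trans (*-congʳ x≈0) (zeroˡ y)) xy<0
    y≉0 : ¬ (y ≈ 0#)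
    y≉0 y≈0 = <-irrefl (trans (*-congˡ y≈0) (zeroʳ x)) xy<0
    positive : ∀ {z} → 0# ≤ z → z # 0# → 0# < z
    positive 0≤z z#0 with #⇒<⊎> z#0
    ... | inj₁ z<0 = contradiction z<0 0≤z
    ... | inj₂ 0<z = 0<z

  x-y+y≈x : ∀ x y → (x - y) + y ≈ x
  x-y+y≈x x y = trans (+-assoc x (- y) y) (trans (+-congˡ (-‿inverseˡ y)) (+-identityʳ x))

  x≤y⇒0≤y-x : ∀ {x y} → x ≤ y → 0# ≤ y - x
  x≤y⇒0≤y-x {x} {y} x≤y = begin
    0#    ≈⟨ -‿inverseʳ x ⟨
    x - x ≲⟨ +-mono-≤ x≤y ≤-refl ⟩
    y - x ∎

  -- Writing `y` as `x + (y - x)` reduces this to `*-nonneg`, so no case split on the order occurs.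
  *-monoˡ-≤ : ∀ {x y z} → 0# ≤ z → x ≤ y → z * x ≤ z * y
  *-monoˡ-≤ {x} {y} {z} 0≤z x≤y = begin
    z * x               ≲⟨ x≤x+y (*-nonneg 0≤z (x≤y⇒0≤y-x x≤y)) ⟩
    z * x + z * (y - x) ≈⟨ distribˡ z x (y - x) ⟨
    z * (x + (y - x))   ≈⟨ *-congˡ (trans (+-comm x (y - x)) (x-y+y≈x y x)) ⟩
    z * y               ∎

  *-monoʳ-≤ : ∀ {x y z} → 0# ≤ z → x ≤ y → x * z ≤ y * z
  *-monoʳ-≤ {x} {y} {z} 0≤z x≤y = begin
    x * z ≈⟨ *-comm x z ⟩
    z * x ≲⟨ *-monoˡ-≤ 0≤z x≤y ⟩
    z * y ≈⟨ *-comm z y ⟩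
    y * z ∎

  *-mono-≤ : ∀ {x y u v} → 0# ≤ y → 0# ≤ u → x ≤ y → u ≤ v → x * u ≤ y * v
  *-mono-≤ 0≤y 0≤u x≤y u≤v = ≤-trans (*-monoʳ-≤ 0≤u x≤y) (*-monoˡ-≤ 0≤y u≤v)

  x*y≤y : ∀ {x y} → 0# ≤ y → x ≤ 1# → x * y ≤ y
  x*y≤y {x} {y} 0≤y x≤1 = ≤-trans (*-monoʳ-≤ 0≤y x≤1) (≤-reflexive (*-identityˡ y))

  ×-nonneg : ∀ {x} k → 0# ≤ x → 0# ≤ k × x
  ×-nonneg zero    0≤x = ≤-refl
  ×-nonneg (suc k) 0≤x = +-nonneg 0≤x (×-nonneg k 0≤x)

  module _ (0<1 : 0# < 1#) where

    ^-nonneg : ∀ {x} k → 0# ≤ x → 0# ≤ x ^ k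
    ^-nonneg zero    0≤x = <⇒≤ 0<1
    ^-nonneg (suc k) 0≤x = *-nonneg 0≤x (^-nonneg k 0≤x)

    ^-≤1 : ∀ {x} k → 0# ≤ x → x ≤ 1# → x ^ k ≤ 1#
    ^-≤1 zero    0≤x x≤1 = ≤-refl
    ^-≤1 (suc k) 0≤x x≤1 = ≤-trans (x*y≤y (^-nonneg k 0≤x) x≤1) (^-≤1 k 0≤x x≤1)

    recip-inverse : ∀ {x} (0<x : 0# < x) → recip x 0<x * x ≈ 1#
    recip-inverse {x} 0<x = trans (*-congˡ x≈x-0)
      (proj₁ (proj₂ (#⇒invertible (#-sym (<⇒# 0<x)))))
      where
      x≈x-0 : x ≈ x - 0#
      x≈x-0 = trans (sym (x-y+y≈x x 0#)) (+-identityʳ (x - 0#))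

    recip-nonneg : ∀ {x} (0<x : 0# < x) → 0# ≤ recip x 0<x
    recip-nonneg {x} 0<x r<0 = contradiction 0<1 (begin
      1#     ≈⟨ recip-inverse 0<x ⟨
      r * x  ≲⟨ *-monoʳ-≤ (<⇒≤ 0<x) (<⇒≤ r<0) ⟩
      0# * x ≈⟨ zeroˡ x ⟩
      0#     ∎)
      where r = recip x 0<x

-- Recursive form of the objective and the window estimate.

module Walk {c ℓ₁ ℓ₂} (F : OrderedField c ℓ₁ ℓ₂) {a} {A : Set a}
  (p : A → OrderedField.Carrier F) (d : A → A → OrderedField.Carrier F) where
  open OrderedField F
  open OrderedFieldProperties F
  open import Relation.Binary.Reasoning.Preorder ≤-preorder
  open import Algebra.Solver.Ring.NaturalCoefficients.Default commutativeSemiring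

  -- ∑ p_{O_j} over 1 ≤ j ≤ m, by Horner's scheme.
  weight : ℕ → (ℕ → A) → Carrier
  weight zero    x = 0#
  weight (suc m) x = p (x 0) * (1# + weight m (x ∘ suc))

  -- The path objective on the first `m` items: every prefix product contains `p (x 0)`, which is
  -- factored out. For one item the edge to `x 1` gets weight `0#`.
  value : ℕ → (ℕ → A) → Carrier
  value zero    x = 0#
  value (suc m) x = p (x 0) * (weight m (x ∘ suc) * d (x 0) (x 1) + value m (x ∘ suc))

  -- The factor by which whatever follows the first `m` items is discounted.
  reach : ℕ → (ℕ → A) → Carrier
  reach zero    x = 1#
  reach (suc m) x = p (x 0) * reach m (x ∘ suc)

  module _ (0<1 : 0# < 1#) (0≤p : ∀ i → 0# ≤ p i) (0≤d : ∀ i j → 0# ≤ d i j) where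

    weight-nonneg : ∀ m x → 0# ≤ weight m x
    weight-nonneg zero    x = ≤-refl
    weight-nonneg (suc m) x =
      *-nonneg (0≤p _) (+-nonneg (<⇒≤ 0<1) (weight-nonneg m (x ∘ suc)))

    value-nonneg : ∀ m x → 0# ≤ value m x
    value-nonneg zero    x = ≤-refl
    value-nonneg (suc m) x = *-nonneg (0≤p _)
      (+-nonneg (*-nonneg (weight-nonneg m (x ∘ suc)) (0≤d _ _)) (value-nonneg m (x ∘ suc)))

    weight-mono : ∀ {m n} → m ℕ.≤ n → ∀ x → weight m x ≤ weight n x
    weight-mono {n = n} ℕ.z≤n x = weight-nonneg n x
    weight-mono (ℕ.s≤s m≤n)   x =
      *-monoˡ-≤ (0≤p _) (+-monoʳ-≤ 1# (weight-mono m≤n (x ∘ suc)))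

    value-mono : ∀ {m n} → m ℕ.≤ n → ∀ x → value m x ≤ value n x
    value-mono {n = n} ℕ.z≤n x = value-nonneg n x
    value-mono (ℕ.s≤s m≤n)   x = *-monoˡ-≤ (0≤p _)
      (+-mono-≤ (*-monoʳ-≤ (0≤d _ _) (weight-mono m≤n (x ∘ suc))) (value-mono m≤n (x ∘ suc)))

    -- `c` stands for `1# - b`; describing it by `c + b ≈ 1#` keeps subtraction out of the semiring
    -- identities.
    module _ {b c} (c+b≈1 : c + b ≈ 1#) (0≤b : 0# ≤ b) (0≤c : 0# ≤ c) (p≤b : ∀ i → p i ≤ b) where

      c≤1 : c ≤ 1#
      c≤1 = ≤-trans (x≤x+y 0≤b) (≤-reflexive c+b≈1)

      distrib-weight : ∀ q w → c * (q * (1# + w)) ≈ q * (c + c * w)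
      distrib-weight = solve 3 (λ c q w → c :* (q :* (con 1 :+ w)) := q :* (c :+ c :* w)) refl c

      -- The geometric series `b + b ^ 2 + …` has sum `b / (1# - b)`; the denominator is cleared so
      -- that the induction closes through `c + b ≈ 1#`.
      weight-bound : ∀ m x → c * weight m x ≤ b
      weight-bound zero    x = ≤-trans (≤-reflexive (zeroʳ c)) 0≤b
      weight-bound (suc m) x = begin
        c * (q * (1# + w)) ≈⟨ distrib-weight q w ⟩
        q * (c + c * w)    ≲⟨ *-monoˡ-≤ (0≤p _) (+-monoʳ-≤ c (weight-bound m (x ∘ suc))) ⟩
        q * (c + b)        ≈⟨ *-congˡ c+b≈1 ⟩
        q * 1#             ≈⟨ *-identityʳ q ⟩
        q                  ≲⟨ p≤b _ ⟩
        b                  ∎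
        where
        q = p (x 0)
        w = weight m (x ∘ suc)

      -- The last kept item absorbs the whole tail, since there `c + c * w ≤ c + b ≈ 1#`. At the
      -- items before it, `c ≤ 1#` suffices.
      weight-truncate : ∀ s m x → c * weight (s ℕ.+ m) x ≤ weight (suc s) x
      weight-truncate zero zero    x = ≤-trans (≤-reflexive (zeroʳ c)) (weight-nonneg 1 x)
      weight-truncate zero (suc m) x = begin
        c * (q * (1# + w)) ≈⟨ distrib-weight q w ⟩
        q * (c + c * w)    ≲⟨ *-monoˡ-≤ (0≤p _) (+-monoʳ-≤ c (weight-bound m (x ∘ suc))) ⟩
        q * (c + b)        ≈⟨ *-congˡ (trans c+b≈1 (sym (+-identityʳ 1#))) ⟩
        q * (1# + 0#)      ∎
        where
        q = p (x 0)
        w = weight m (x ∘ suc)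
      weight-truncate (suc s) m x = begin
        c * (q * (1# + w)) ≈⟨ distrib-weight q w ⟩
        q * (c + c * w)    ≲⟨ *-monoˡ-≤ (0≤p _) (+-mono-≤ c≤1 (weight-truncate s m (x ∘ suc))) ⟩
        q * (1# + weight (suc s) (x ∘ suc)) ∎
        where
        q = p (x 0)
        w = weight (s ℕ.+ m) (x ∘ suc)

      -- A window of `s` edges has `suc s` items, and its last item opens the next window: hence
      -- `suc s` beside `drop s`. The remainder keeps its factor `c`, ready to be split again.
      value-split : ∀ s m x →
        c * value (s ℕ.+ m) x ≤ value (suc s) x + reach s x * (c * value m (drop s x))
      value-split zero m x = begin
        c * value m x                         ≈⟨ *-identityˡ (c * value m x) ⟨
        1# * (c * value m x)                  ≈⟨ +-identityˡ _ ⟨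
        0# + 1# * (c * value m x)             ≲⟨ +-mono-≤ (value-nonneg 1 x) ≤-refl ⟩
        value 1 x + 1# * (c * value m x)      ∎
      value-split (suc s) m x = begin
        c * (q * (w * e + v))
          ≈⟨ solve 5 (λ c q w e v → c :* (q :* (w :* e :+ v)) := q :* (c :* w :* e :+ c :* v)) refl c q w e v ⟩
        q * (c * w * e + c * v)
          ≲⟨ *-monoˡ-≤ (0≤p _) (+-mono-≤ (*-monoʳ-≤ (0≤d _ _) (weight-truncate s m (x ∘ suc)))
                                          (value-split s m (x ∘ suc))) ⟩
        q * (w′ * e + (v′ + r * t))
          ≈⟨ solve 6 (λ q w e v r t → q :* (w :* e :+ (v :+ r :* t)) := q :* (w :* e :+ v) :+ q :* r :* t)
               refl q w′ e v′ r t ⟩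
        q * (w′ * e + v′) + q * r * t ∎
        where
        q = p (x 0)
        e = d (x 0) (x 1)
        w = weight (s ℕ.+ m) (x ∘ suc)
        v = value (s ℕ.+ m) (x ∘ suc)
        w′ = weight (suc s) (x ∘ suc)
        v′ = value (suc s) (x ∘ suc)
        r = reach s (x ∘ suc)
        t = c * value m (drop s (x ∘ suc))

      reach-nonneg : ∀ s x → 0# ≤ reach s x
      reach-nonneg zero    x = <⇒≤ 0<1
      reach-nonneg (suc s) x = *-nonneg (0≤p _) (reach-nonneg s (x ∘ suc))

      reach-≤ : ∀ s x → reach s x ≤ b ^ s
      reach-≤ zero    x = ≤-refl
      reach-≤ (suc s) x = *-mono-≤ 0≤b (reach-nonneg s (x ∘ suc)) (p≤b _) (reach-≤ s (x ∘ suc))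

      -- The geometric series over the windows, with `C` for `1# - b ^ s`: one window contributes
      -- `C * V`, the rest at most `b ^ s * V`, and together they give `V` again. All offsets `k`
      -- are assumed so that the hypothesis passes to `drop s x`.
      value-bound : ∀ {V C} s → 0# ≤ V → 0# ≤ C → C + b ^ s ≈ 1# →
        ∀ r x → (∀ k → value (suc s) (drop k x) ≤ V) → c * C * value (r ℕ.* s) x ≤ V
      value-bound {V} {C} s 0≤V 0≤C C+B≈1 zero    x windows =
        ≤-trans (≤-reflexive (zeroʳ (c * C))) 0≤V
      value-bound {V} {C} s 0≤V 0≤C C+B≈1 (suc r) x windows = begin
        c * C * v
          ≈⟨ solve 3 (λ c C v → c :* C :* v := C :* (c :* v)) refl c C v ⟩
        C * (c * v)
          ≲⟨ *-monoˡ-≤ 0≤C (value-split s (r ℕ.* s) x) ⟩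
        C * (u + q * (c * v′))
          ≈⟨ solve 5 (λ C u q c v → C :* (u :+ q :* (c :* v)) := C :* u :+ q :* (c :* C :* v)) refl C u q c v′ ⟩
        C * u + q * (c * C * v′)
          ≲⟨ +-mono-≤ (*-monoˡ-≤ 0≤C (windows 0))
                       (*-monoˡ-≤ (reach-nonneg s x) (value-bound s 0≤V 0≤C C+B≈1 r (drop s x) windows′)) ⟩
        C * V + q * V
          ≲⟨ +-monoʳ-≤ (C * V) (*-monoʳ-≤ 0≤V (reach-≤ s x)) ⟩
        C * V + b ^ s * V
          ≈⟨ distribʳ V C (b ^ s) ⟨
        (C + b ^ s) * V
          ≈⟨ *-congʳ C+B≈1 ⟩
        1# * V
          ≈⟨ *-identityˡ V ⟩
        V ∎
        where
        v = value (s ℕ.+ r ℕ.* s) x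
        v′ = value (r ℕ.* s) (drop s x)
        u = value (suc s) x
        q = reach s x
        windows′ : ∀ k → value (suc s) (drop k (drop s x)) ≤ V
        windows′ k = ≡.subst (λ y → value (suc s) y ≤ V) (≡.sym (drop-drop s k x)) (windows (s ℕ.+ k))

-- Agreement of the defining sums with the recursive form.

module ObjectiveProperties {c ℓ₁ ℓ₂} (F : OrderedField c ℓ₁ ℓ₂) {n : ℕ}
  (p : Fin n → OrderedField.Carrier F) (d : Fin n → Fin n → OrderedField.Carrier F) where
  open OrderedField F hiding (zero)
  open OrderedHamiltonianPath F p d
  open OrderedFieldProperties F using (commutativeSemiring)
  open Walk F p d
  open SemiringSum semiring using (sum-cong-≋; *-distribˡ-sum; *-distribʳ-sum)
  open import Relation.Binary.Reasoning.Setoid setoid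
  open import Algebra.Solver.Ring.NaturalCoefficients.Default commutativeSemiring
    using (solve; _:=_; _:+_; _:*_; con)

  *-distribˡ-if : ∀ t x y → (if t then x * y else 0#) ≈ x * (if t then y else 0#)
  *-distribˡ-if true  x y = refl
  *-distribˡ-if false x y = sym (zeroʳ x)

  *-distribʳ-if : ∀ t x y → (if t then x * y else 0#) ≈ (if t then x else 0#) * y
  *-distribʳ-if true  x y = refl
  *-distribʳ-if false x y = sym (zeroˡ y)

  sum-prefixProb : ∀ {k} (π : Fin k → Fin n) (x : ℕ → Fin n) → (∀ i → π i ≡ x (toℕ i)) →
    sum (prefixProb π) ≈ weight k x
  sum-prefixProb {zero}  π x π≗x = refl
  sum-prefixProb {suc k} π x π≗x = begin
    -- By computation `q` splits off every prefix product; at position `zero` the empty product `1#`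
    -- is left.
    q * 1# + ∑[ j < k ] (q * prefixProb (π ∘ suc) j)
      ≈⟨ +-congˡ (*-distribˡ-sum q (prefixProb (π ∘ suc))) ⟨
    q * 1# + q * sum (prefixProb (π ∘ suc))
      ≈⟨ distribˡ q 1# _ ⟨
    q * (1# + sum (prefixProb (π ∘ suc)))
      ≈⟨ *-cong (reflexive (≡.cong p (π≗x zero)))
           (+-congˡ (sum-prefixProb (π ∘ suc) (x ∘ suc) (π≗x ∘ suc))) ⟩
    p (x 0) * (1# + weight k (x ∘ suc)) ∎
    where q = p (π zero)

  -- The summand at position `zero` is `0#`, as `0 <ᵇ 0` is `false`; at all later positions the test
  -- computes to `true`.
  W-zero : ∀ {k} (π : Fin (suc k) → Fin n) → W π zero ≈ p (π zero) * sum (prefixProb (π ∘ suc))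
  W-zero π = trans (+-identityˡ _) (sym (*-distribˡ-sum (p (π zero)) (prefixProb (π ∘ suc))))

  W-suc : ∀ {k} (π : Fin (suc k) → Fin n) i → W π (suc i) ≈ p (π zero) * W (π ∘ suc) i
  W-suc {k} π i = begin
    0# + ∑[ j < k ] (if toℕ i <ᵇ toℕ j then q * prefixProb (π ∘ suc) j else 0#)
      ≈⟨ +-identityˡ _ ⟩
    ∑[ j < k ] (if toℕ i <ᵇ toℕ j then q * prefixProb (π ∘ suc) j else 0#)
      ≈⟨ sum-cong-≋ {k} (λ j → *-distribˡ-if (toℕ i <ᵇ toℕ j) q (prefixProb (π ∘ suc) j)) ⟩
    ∑[ j < k ] (q * (if toℕ i <ᵇ toℕ j then prefixProb (π ∘ suc) j else 0#))
      ≈⟨ *-distribˡ-sum {k} q _ ⟨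
    q * W (π ∘ suc) i ∎
    where q = p (π zero)

  -- Any extension `x` of `π` is allowed, so this covers whole orderings, prefixes and shifted
  -- windows alike.
  pathObjective≈value : ∀ {k} (π : Fin k → Fin n) (x : ℕ → Fin n) → (∀ i → π i ≡ x (toℕ i)) →
    pathObjective π ≈ value k x
  pathObjective≈value {zero}        π x π≗x = refl
  pathObjective≈value {suc zero}    π x π≗x =
    sym (solve 2 (λ q e → q :* (con 0 :* e :+ con 0) := con 0) refl (p (x 0)) (d (x 0) (x 1)))
  pathObjective≈value {suc (suc k)} π x π≗x = begin
    W π zero * e + ∑[ i < k ] (W π (suc (inject₁ i)) * e′ i)
      ≈⟨ +-cong (*-congʳ (W-zero π)) (sum-cong-≋ {k} λ i →
           trans (*-congʳ (W-suc π (inject₁ i))) (*-assoc q (W (π ∘ suc) (inject₁ i)) (e′ i))) ⟩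
    q * w * e + ∑[ i < k ] (q * (W (π ∘ suc) (inject₁ i) * e′ i))
      ≈⟨ +-congˡ (*-distribˡ-sum {k} q _) ⟨
    q * w * e + q * pathObjective (π ∘ suc)
      ≈⟨ solve 4 (λ q w e v → q :* w :* e :+ q :* v := q :* (w :* e :+ v)) refl q w e _ ⟩
    q * (w * e + pathObjective (π ∘ suc))
      ≈⟨ *-cong (reflexive (≡.cong p (π≗x zero)))
           (+-cong (*-cong (sum-prefixProb (π ∘ suc) (x ∘ suc) (π≗x ∘ suc))
                           (reflexive (≡.cong₂ d (π≗x zero) (π≗x (suc zero)))))
                   (pathObjective≈value (π ∘ suc) (x ∘ suc) (π≗x ∘ suc))) ⟩
    value (suc (suc k)) x ∎
    where
    q = p (π zero)
    w = sum (prefixProb (π ∘ suc))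
    e = d (π zero) (π (suc zero))
    e′ : Fin k → Carrier
    e′ i = d (π (suc (inject₁ i))) (π (suc (suc i)))

  -- The distance does not depend on `j`, so it leaves the inner sum, and what remains is `W`.
  truncatedObjective≈pathObjective : ∀ {k} (π : Fin k → Fin n) →
    truncatedObjective π ≈ pathObjective π
  truncatedObjective≈pathObjective {zero}  π = refl
  truncatedObjective≈pathObjective {suc m} π = sum-cong-≋ {m} λ i →
    let e = d (π (inject₁ i)) (π (suc i))
        P = λ (j : Fin (suc m)) → if toℕ i <ᵇ toℕ j then prefixProb π j else 0# in begin
    ∑[ j < suc m ] (if toℕ i <ᵇ toℕ j then prefixProb π j * e else 0#)
      ≈⟨ sum-cong-≋ {suc m} (λ j → *-distribʳ-if (toℕ i <ᵇ toℕ j) (prefixProb π j) e) ⟩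
    ∑[ j < suc m ] (P j * e)
      ≈⟨ *-distribʳ-sum e P ⟨
    sum P * e
      -- `W` tests `toℕ (inject₁ i)`, which equals `toℕ i` only propositionally.
      ≡⟨ ≡.cong (λ t → (∑[ j < suc m ] (if t <ᵇ toℕ j then prefixProb π j else 0#)) * e)
           (toℕ-inject₁ i) ⟨
    W π (inject₁ i) * e ∎

  truncatedObjective≈value : ∀ {k} (π : Fin k → Fin n) (x : ℕ → Fin n) → (∀ i → π i ≡ x (toℕ i)) →
    truncatedObjective π ≈ value k x
  truncatedObjective≈value π x π≗x =
    trans (truncatedObjective≈pathObjective π) (pathObjective≈value π x π≗x)

-- The approximation guarantee.

theorem7p1 : ∀ {c ℓ₁ ℓ₂} (F : OrderedField c ℓ₁ ℓ₂) → let open OrderedField F in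
    (n : ℕ) (p : Fin n → Carrier) (d : Fin n → Fin n → Carrier) →
    let open OrderedHamiltonianPath F p d in
    IsDistance F d →
    (a b : Carrier) (0<a : 0# < a) (a≤b : a ≤ b) → b < 1# →
    (∀ i → a ≤ p i) → (∀ i → p i ≤ b) →
    (τ : ℕ) → 2 ℕ.≤ τ → (τ≤n : τ ℕ.≤ n) →
    (O : Ordering) → BτIOutput τ τ≤n O →
    AchievesRatio (approximationRatio F 0<a a≤b τ) O
theorem7p1 F zero    p d dist a b 0<a a≤b b<1 a≤p p≤b (suc (suc s)) _               ()  O out O′
theorem7p1 F (suc n) p d dist a b 0<a a≤b b<1 a≤p p≤b (suc (suc s)) (ℕ.s≤s (ℕ.s≤s _)) τ≤n O out O′ = begin
  (a ^ 2 * c * C) * r * ℋ O′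
    -- The ratio is regrouped as `a ^ 2 * r`, which is at most `1#`, times the window factor
    -- `c * C`.
    ≈⟨ solve 5 (λ A c C r h → (A :* c :* C) :* r :* h := A :* r :* (c :* C :* h)) refl (a ^ 2) c C r (ℋ O′) ⟩
  a ^ 2 * r * (c * C * ℋ O′)
    ≲⟨ *-monoˡ-≤ 0≤a²r cCℋO′≤V ⟩
  a ^ 2 * r * V
    ≲⟨ x*y≤y 0≤V a²r≤1 ⟩
  V
    ≈⟨ truncatedObjective≈value (Injection.to Oτ) y Oτ≗y ⟩
  value τ y
    ≲⟨ value-mono 0<1 0≤p nonneg τ≤n y ⟩
  value (suc n) y
    ≈⟨ pathObjective≈value (O ⟨$⟩ʳ_) y (λ i → ≡.sym (cyclic-toℕ (O ⟨$⟩ʳ_) i)) ⟨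
  ℋ O ∎
  where
  open OrderedField F
  open OrderedFieldProperties F
  open OrderedHamiltonianPath F p d
  open ObjectiveProperties F p d
  open Walk F p d
  open IsDistance dist
  open BτIOutput out
  open import Relation.Binary.Reasoning.Preorder ≤-preorder
  open import Algebra.Solver.Ring.NaturalCoefficients.Default commutativeSemiring
    using (solve; _:=_; _:*_)

  -- A window of `τ` items has `suc s` edges, which is also what `τ ∸ 1` computes to.
  τ : ℕ
  τ = suc (suc s)

  c C D r V : Carrier
  c = 1# - b
  C = 1# - b ^ suc s
  D = ratioDenominator F a b τ
  r = recip D (ratioDenominator-pos F 0<a a≤b τ)
  V = ℋ̃ Oτ

  x y : ℕ → Fin (suc n)
  x = cyclic (O′ ⟨$⟩ʳ_)
  y = cyclic (O ⟨$⟩ʳ_)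

  0≤a : 0# ≤ a
  0≤a = <⇒≤ 0<a

  0≤b : 0# ≤ b
  0≤b = ≤-trans 0≤a a≤b

  0<1 : 0# < 1#
  0<1 = <-trans (<-≤-trans 0<a a≤b) b<1

  0≤p : ∀ i → 0# ≤ p i
  0≤p i = ≤-trans 0≤a (a≤p i)

  0≤c : 0# ≤ c
  0≤c = x≤y⇒0≤y-x (<⇒≤ b<1)

  0≤C : 0# ≤ C
  0≤C = x≤y⇒0≤y-x (^-≤1 0<1 (suc s) 0≤b (<⇒≤ b<1))

  Oτ≗y : ∀ i → Injection.to Oτ i ≡ y (toℕ i)
  Oτ≗y i = ≡.trans (≡.sym (extends i))
    (≡.trans (≡.sym (cyclic-toℕ (O ⟨$⟩ʳ_) (inject≤ i τ≤n))) (≡.cong y (toℕ-inject≤ i τ≤n)))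

  0≤V : 0# ≤ V
  0≤V = ≤-trans (value-nonneg 0<1 0≤p nonneg τ y)
    (≤-reflexive (sym (truncatedObjective≈value (Injection.to Oτ) y Oτ≗y)))

  windows : ∀ k → value τ (drop k x) ≤ V
  windows k = ≤-trans
    (≤-reflexive (sym (truncatedObjective≈value (Injection.to S) (drop k x) (λ i → ≡.sym (drop-lookup k x (toℕ i))))))
    (maximal S)
    where
    -- A window may wrap around the end of `O′`; its positions stay distinct because `τ ≤ suc n`.
    S : DistinctSequence τ
    S = mk↣ {to = λ i → x (k ℕ.+ toℕ i)}
      (λ eq → mod-window-injective τ≤n k (Injection.injective (↔⇒↣ O′) eq))

  cCℋO′≤V : c * C * ℋ O′ ≤ V
  cCℋO′≤V = begin
    c * C * ℋ O′
      ≈⟨ *-congˡ (pathObjective≈value (O′ ⟨$⟩ʳ_) x (λ i → ≡.sym (cyclic-toℕ (O′ ⟨$⟩ʳ_) i))) ⟩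
    c * C * value (suc n) x
      -- `value-bound` wants a multiple of the window length `suc s`. Running on cyclically to
      -- `suc n` full windows reaches one and only increases the value.
      ≲⟨ *-monoˡ-≤ (*-nonneg 0≤c 0≤C)
           (value-mono 0<1 0≤p nonneg (ℕₚ.m≤m*n (suc n) (suc s)) x) ⟩
    c * C * value (suc n ℕ.* suc s) x
      ≲⟨ value-bound 0<1 0≤p nonneg (x-y+y≈x 1# b) 0≤b 0≤c p≤b (suc s)
           0≤V 0≤C (x-y+y≈x 1# (b ^ suc s)) (suc n) x windows ⟩
    V ∎

  0≤r : 0# ≤ r
  0≤r = recip-nonneg 0<1 (ratioDenominator-pos F 0<a a≤b τ)

  0≤a²r : 0# ≤ a ^ 2 * r
  0≤a²r = *-nonneg (^-nonneg 0<1 2 0≤a) 0≤r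

  a²r≤1 : a ^ 2 * r ≤ 1#
  a²r≤1 = begin
    a ^ 2 * r ≲⟨ *-monoʳ-≤ 0≤r (x≤x+y (×-nonneg (suc s) (^-nonneg 0<1 (suc τ) 0≤b))) ⟩
    D * r     ≈⟨ *-comm D r ⟩
    r * D     ≈⟨ recip-inverse 0<1 (ratioDenominator-pos F 0<a a≤b τ) ⟩
    1#        ∎
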